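{- Let $G$ be a vertex-transitive nut graph on $n$ vertices, of degree $d$ (every vertex of $G$ has exactly $d$ neighbours). Then $n$ and $d$ satisfy the following conditions. Either $d \equiv 0 \pmod 4$, and $n \equiv 0 \pmod 2$, and $n \geq d+4$; or $d \equiv 2 \pmod 4$, and $n \equiv 0 \pmod 4$, and $n \geq d+6$.
   Context: All graphs are finite and simple (no loops, no multiple edges). For a graph $G$ on $n$ vertices, $\mathbf{A}(G)$ denotes its $n \times n$ $0$-$1$ adjacency matrix. A nut graph is a graph $G$ with $n>1$ vertices such that the kernel of $\mathbf{A}(G)$ (over $\mathbb{R}$) is one-dimensional and is spanned by a vector with no zero entries. (The single isolated vertex, the trivial case, is not counted as a nut graph.) A graph $G$ is vertex-transitive if its automorphism group $\operatorname{Aut}(G)$ acts transitively on its vertices. -}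

module Defs where

open import Algebra.Bundles using (CommutativeRing)
import Algebra.Properties.Semiring.Sum as SemiringSum
open import Data.Bool.Base using (Bool; false; if_then_else_)
open import Data.Fin.Base using (Fin)
open import Data.Fin.Permutation using (Permutation′; _⟨$⟩ʳ_)
open import Data.Fin.Subset using (Subset; ∣_∣)
open import Data.Nat.Base as ℕ using (ℕ)
import Data.Nat.Properties as ℕₚ
open import Data.Product.Base using (∃-syntax; _×_; _,_)
open import Data.Rational.Base as ℚ using (ℚ; 0ℚ; 1ℚ; ½)
import Data.Rational.Properties as ℚₚ
open import Data.Rational.Solver using (module +-*-Solver)
open import Data.Vec.Base using (tabulate)
open import Data.Vec.Functional using (Vector)
open import Level using (0ℓ)
open import Relation.Binary.PropositionalEquality using (_≡_; refl; sym; trans; cong; subst; subst₂)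
open import Relation.Nullary using (¬_)

-- The real numbers are Cauchy sequences of rationals, taken as a setoid whose
-- equality is "the difference tends to zero"; the operations are pointwise.

IsCauchy : (ℕ → ℚ) → Set
IsCauchy s = ∀ ε → 0ℚ ℚ.< ε →
  ∃[ N ] (∀ m n → N ℕ.≤ m → N ℕ.≤ n → ℚ.∣ s m ℚ.- s n ∣ ℚ.< ε)

TendsToZero : (ℕ → ℚ) → Set
TendsToZero s = ∀ ε → 0ℚ ℚ.< ε → ∃[ N ] (∀ n → N ℕ.≤ n → ℚ.∣ s n ∣ ℚ.< ε)

record ℝ : Set where
  constructor mkℝ
  field
    seq    : ℕ → ℚ
    cauchy : IsCauchy seq

open ℝ public

infix 4 _≈_

record _≈_ (x y : ℝ) : Set where
  constructor mk≈
  field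
    null : TendsToZero (λ n → seq x n ℚ.- seq y n)

open _≈_ public

abstract
  half-pos : ∀ {ε} → 0ℚ ℚ.< ε → 0ℚ ℚ.< ε ℚ.* ½
  half-pos {ε} 0<ε = subst (ℚ._< ε ℚ.* ½) (ℚₚ.*-zeroˡ ½) (ℚₚ.*-monoˡ-<-pos ½ 0<ε)

  half+half : ∀ ε → ε ℚ.* ½ ℚ.+ ε ℚ.* ½ ≡ ε
  half+half ε = trans (sym (ℚₚ.*-distribˡ-+ ε ½ ½)) (ℚₚ.*-identityʳ ε)

  add-small : ∀ {ε c} a b → c ≡ a ℚ.+ b →
              ℚ.∣ a ∣ ℚ.< ε ℚ.* ½ → ℚ.∣ b ∣ ℚ.< ε ℚ.* ½ → ℚ.∣ c ∣ ℚ.< ε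
  add-small {ε} a b refl a< b< =
    subst (ℚ.∣ a ℚ.+ b ∣ ℚ.<_) (half+half ε)
      (ℚₚ.≤-<-trans (ℚₚ.∣p+q∣≤∣p∣+∣q∣ a b) (ℚₚ.+-mono-< a< b<))

  mul-small : ∀ {M} → 0ℚ ℚ.< M → ∀ ε → 0ℚ ℚ.< ε →
              ∃[ δ ] 0ℚ ℚ.< δ ×
                (∀ a b → ℚ.∣ a ∣ ℚ.< M → ℚ.∣ b ∣ ℚ.< δ → ℚ.∣ a ℚ.* b ∣ ℚ.< ε)
  mul-small {M} 0<M ε 0<ε = δ , 0<δ , bound
    where
    instance
      M-pos : ℚ.Positive M
      M-pos = ℚ.positive 0<M
      M-nonZero : ℚ.NonZero M
      M-nonZero = ℚₚ.pos⇒nonZero M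
      1/M-pos : ℚ.Positive (ℚ.1/ M)
      1/M-pos = ℚₚ.1/pos⇒pos M
    δ : ℚ
    δ = ε ℚ.* ℚ.1/ M
    0<δ : 0ℚ ℚ.< δ
    0<δ = subst (ℚ._< δ) (ℚₚ.*-zeroˡ (ℚ.1/ M)) (ℚₚ.*-monoˡ-<-pos (ℚ.1/ M) 0<ε)
    Mδ≡ε : M ℚ.* δ ≡ ε
    Mδ≡ε = trans (ℚₚ.*-comm M δ) (trans (ℚₚ.*-assoc ε (ℚ.1/ M) M)
             (trans (cong (ε ℚ.*_) (ℚₚ.*-inverseˡ M)) (ℚₚ.*-identityʳ ε)))
    bound : ∀ a b → ℚ.∣ a ∣ ℚ.< M → ℚ.∣ b ∣ ℚ.< δ → ℚ.∣ a ℚ.* b ∣ ℚ.< ε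
    bound a b a<M b<δ = subst₂ ℚ._<_ (sym (ℚₚ.∣p*q∣≡∣p∣*∣q∣ a b)) Mδ≡ε
      (ℚₚ.≤-<-trans
        (ℚₚ.*-monoˡ-≤-nonNeg ℚ.∣ a ∣ {{ℚₚ.∣-∣-nonNeg a}} (ℚₚ.<⇒≤ b<δ))
        (ℚₚ.*-monoˡ-<-pos δ {{ℚ.positive 0<δ}} a<M))

  bounded : ∀ x → ∃[ M ] 0ℚ ℚ.< M × ∃[ N ] (∀ n → N ℕ.≤ n → ℚ.∣ seq x n ∣ ℚ.< M)
  bounded x with cauchy x 1ℚ (ℚₚ.positive⁻¹ 1ℚ)
  ... | N , close = M , ℚₚ.≤-<-trans (ℚₚ.0≤∣p∣ (seq x N)) (below N ℕₚ.≤-refl) , N , below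
    where
    M : ℚ
    M = 1ℚ ℚ.+ ℚ.∣ seq x N ∣
    below : ∀ n → N ℕ.≤ n → ℚ.∣ seq x n ∣ ℚ.< M
    below n N≤n = ℚₚ.≤-<-trans
      (subst (λ z → ℚ.∣ z ∣ ℚ.≤ ℚ.∣ seq x n ℚ.- seq x N ∣ ℚ.+ ℚ.∣ seq x N ∣)
        (solve 2 (λ a b → (a :- b) :+ b := a) refl (seq x n) (seq x N))
        (ℚₚ.∣p+q∣≤∣p∣+∣q∣ (seq x n ℚ.- seq x N) (seq x N)))
      (ℚₚ.+-monoˡ-< ℚ.∣ seq x N ∣ (close n N N≤n ℕₚ.≤-refl))
      where open +-*-Solver

  ⊔-left : ∀ {k} m n → m ℕ.⊔ n ℕ.≤ k → m ℕ.≤ k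
  ⊔-left = ℕₚ.m⊔n≤o⇒m≤o

  ⊔-right : ∀ {k} m n → m ℕ.⊔ n ℕ.≤ k → n ℕ.≤ k
  ⊔-right = ℕₚ.m⊔n≤o⇒n≤o

  neg-sub : ∀ a b → ℚ.- a ℚ.- ℚ.- b ≡ ℚ.- (a ℚ.- b)
  neg-sub = solve 2 (λ a b → :- a :- :- b := :- (a :- b)) refl
    where open +-*-Solver

  add-sub : ∀ a b c d → (a ℚ.+ b) ℚ.- (c ℚ.+ d) ≡ (a ℚ.- c) ℚ.+ (b ℚ.- d)
  add-sub = solve 4 (λ a b c d → (a :+ b) :- (c :+ d) := (a :- c) :+ (b :- d)) refl
    where open +-*-Solver

  mul-sub : ∀ a b c d → a ℚ.* b ℚ.- c ℚ.* d ≡ a ℚ.* (b ℚ.- d) ℚ.+ d ℚ.* (a ℚ.- c)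
  mul-sub = solve 4 (λ a b c d → a :* b :- c :* d := a :* (b :- d) :+ d :* (a :- c)) refl
    where open +-*-Solver

  small-zero : ∀ {a ε} → a ≡ 0ℚ → 0ℚ ℚ.< ε → ℚ.∣ a ∣ ℚ.< ε
  small-zero refl 0<ε = 0<ε

  const-cauchy : ∀ q → IsCauchy (λ _ → q)
  const-cauchy q _ 0<ε = 0 , λ _ _ _ _ → small-zero (ℚₚ.+-inverseʳ q) 0<ε

  +-cauchy : ∀ x y → IsCauchy (λ n → seq x n ℚ.+ seq y n)
  +-cauchy x y ε 0<ε with cauchy x (ε ℚ.* ½) (half-pos 0<ε) | cauchy y (ε ℚ.* ½) (half-pos 0<ε)
  ... | N₁ , x-close | N₂ , y-close = N₁ ℕ.⊔ N₂ , λ m n N≤m N≤n →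
    add-small (seq x m ℚ.- seq x n) (seq y m ℚ.- seq y n)
      (add-sub (seq x m) (seq y m) (seq x n) (seq y n))
      (x-close m n (⊔-left N₁ N₂ N≤m) (⊔-left N₁ N₂ N≤n))
      (y-close m n (⊔-right N₁ N₂ N≤m) (⊔-right N₁ N₂ N≤n))

  neg-cauchy : ∀ x → IsCauchy (λ n → ℚ.- seq x n)
  neg-cauchy x ε 0<ε with cauchy x ε 0<ε
  ... | N , close = N , λ m n N≤m N≤n →
    subst (ℚ._< ε)
      (sym (trans (cong ℚ.∣_∣ (neg-sub (seq x m) (seq x n))) (ℚₚ.∣-p∣≡∣p∣ (seq x m ℚ.- seq x n))))
      (close m n N≤m N≤n)

  *-cauchy : ∀ x y → IsCauchy (λ n → seq x n ℚ.* seq y n)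
  *-cauchy x y ε 0<ε =
    let A , 0<A , K₁ , x<A = bounded x
        B , 0<B , K₂ , y<B = bounded y
        α , 0<α , α-ok = mul-small 0<A (ε ℚ.* ½) (half-pos 0<ε)
        β , 0<β , β-ok = mul-small 0<B (ε ℚ.* ½) (half-pos 0<ε)
        N₁ , y-close = cauchy y α 0<α
        N₂ , x-close = cauchy x β 0<β
    in (K₁ ℕ.⊔ K₂) ℕ.⊔ (N₁ ℕ.⊔ N₂) , λ m n N≤m N≤n →
    let Km = ⊔-left (K₁ ℕ.⊔ K₂) (N₁ ℕ.⊔ N₂) N≤m
        Kn = ⊔-left (K₁ ℕ.⊔ K₂) (N₁ ℕ.⊔ N₂) N≤n
        Nm = ⊔-right (K₁ ℕ.⊔ K₂) (N₁ ℕ.⊔ N₂) N≤m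
        Nn = ⊔-right (K₁ ℕ.⊔ K₂) (N₁ ℕ.⊔ N₂) N≤n
    in add-small (seq x m ℚ.* (seq y m ℚ.- seq y n)) (seq y n ℚ.* (seq x m ℚ.- seq x n))
         (mul-sub (seq x m) (seq y m) (seq x n) (seq y n))
         (α-ok (seq x m) (seq y m ℚ.- seq y n) (x<A m (⊔-left K₁ K₂ Km))
           (y-close m n (⊔-left N₁ N₂ Nm) (⊔-left N₁ N₂ Nn)))
         (β-ok (seq y n) (seq x m ℚ.- seq x n) (y<B n (⊔-right K₁ K₂ Kn))
           (x-close m n (⊔-right N₁ N₂ Nm) (⊔-right N₁ N₂ Nn)))

fromℚ : ℚ → ℝ
fromℚ q = mkℝ (λ _ → q) (const-cauchy q)

0ℝ 1ℝ : ℝ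
0ℝ = fromℚ 0ℚ
1ℝ = fromℚ 1ℚ

infixl 6 _+_
infixl 7 _*_
infix  8 -_

_+_ : ℝ → ℝ → ℝ
x + y = mkℝ (λ n → seq x n ℚ.+ seq y n) (+-cauchy x y)

-_ : ℝ → ℝ
- x = mkℝ (λ n → ℚ.- seq x n) (neg-cauchy x)

_*_ : ℝ → ℝ → ℝ
x * y = mkℝ (λ n → seq x n ℚ.* seq y n) (*-cauchy x y)

abstract
  ≡⇒≈ : ∀ {x y} → (∀ n → seq x n ≡ seq y n) → x ≈ y
  ≡⇒≈ {x} {y} eq = mk≈ λ _ 0<ε → 0 , λ n _ →
    small-zero (trans (cong (ℚ._- seq y n) (eq n)) (ℚₚ.+-inverseʳ (seq y n))) 0<ε

  ≈-refl : ∀ {x} → x ≈ x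
  ≈-refl = ≡⇒≈ λ _ → refl

  ≈-sym : ∀ {x y} → x ≈ y → y ≈ x
  ≈-sym {x} {y} x≈y = mk≈ proof
    where
    proof : TendsToZero (λ n → seq y n ℚ.- seq x n)
    proof ε 0<ε with null x≈y ε 0<ε
    ... | N , close = N , λ n N≤n →
      subst (ℚ._< ε)
        (trans (sym (ℚₚ.∣-p∣≡∣p∣ (seq x n ℚ.- seq y n)))
          (cong ℚ.∣_∣ (solve 2 (λ a b → :- (a :- b) := b :- a) refl (seq x n) (seq y n))))
        (close n N≤n)
      where open +-*-Solver

  ≈-trans : ∀ {x y z} → x ≈ y → y ≈ z → x ≈ z
  ≈-trans {x} {y} {z} x≈y y≈z = mk≈ proof
    where
    open +-*-Solver
    proof : TendsToZero (λ n → seq x n ℚ.- seq z n)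
    proof ε 0<ε with null x≈y (ε ℚ.* ½) (half-pos 0<ε) | null y≈z (ε ℚ.* ½) (half-pos 0<ε)
    ... | N₁ , xy-close | N₂ , yz-close = N₁ ℕ.⊔ N₂ , λ n N≤n →
      add-small (seq x n ℚ.- seq y n) (seq y n ℚ.- seq z n)
        (solve 3 (λ a b c → a :- c := (a :- b) :+ (b :- c)) refl (seq x n) (seq y n) (seq z n))
        (xy-close n (⊔-left N₁ N₂ N≤n)) (yz-close n (⊔-right N₁ N₂ N≤n))

  +-cong : ∀ {x x′ y y′} → x ≈ x′ → y ≈ y′ → x + y ≈ x′ + y′
  +-cong {x} {x′} {y} {y′} x≈x′ y≈y′ = mk≈ proof
    where
    proof : TendsToZero (λ n → (seq x n ℚ.+ seq y n) ℚ.- (seq x′ n ℚ.+ seq y′ n))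
    proof ε 0<ε with null x≈x′ (ε ℚ.* ½) (half-pos 0<ε) | null y≈y′ (ε ℚ.* ½) (half-pos 0<ε)
    ... | N₁ , x-close | N₂ , y-close = N₁ ℕ.⊔ N₂ , λ n N≤n →
      add-small (seq x n ℚ.- seq x′ n) (seq y n ℚ.- seq y′ n)
        (add-sub (seq x n) (seq y n) (seq x′ n) (seq y′ n))
        (x-close n (⊔-left N₁ N₂ N≤n)) (y-close n (⊔-right N₁ N₂ N≤n))

  -‿cong : ∀ {x y} → x ≈ y → - x ≈ - y
  -‿cong {x} {y} x≈y = mk≈ proof
    where
    proof : TendsToZero (λ n → ℚ.- seq x n ℚ.- ℚ.- seq y n)
    proof ε 0<ε with null x≈y ε 0<ε
    ... | N , close = N , λ n N≤n →
      subst (ℚ._< ε)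
        (sym (trans (cong ℚ.∣_∣ (neg-sub (seq x n) (seq y n))) (ℚₚ.∣-p∣≡∣p∣ (seq x n ℚ.- seq y n))))
        (close n N≤n)

  *-cong : ∀ {x x′ y y′} → x ≈ x′ → y ≈ y′ → x * y ≈ x′ * y′
  *-cong {x} {x′} {y} {y′} x≈x′ y≈y′ = mk≈ proof
    where
    proof : TendsToZero (λ n → seq x n ℚ.* seq y n ℚ.- seq x′ n ℚ.* seq y′ n)
    proof ε 0<ε =
      let A , 0<A , K₁ , x<A = bounded x
          B , 0<B , K₂ , y′<B = bounded y′
          α , 0<α , α-ok = mul-small 0<A (ε ℚ.* ½) (half-pos 0<ε)
          β , 0<β , β-ok = mul-small 0<B (ε ℚ.* ½) (half-pos 0<ε)
          N₁ , y-close = null y≈y′ α 0<α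
          N₂ , x-close = null x≈x′ β 0<β
      in (K₁ ℕ.⊔ K₂) ℕ.⊔ (N₁ ℕ.⊔ N₂) , λ n N≤n →
      let Kn = ⊔-left (K₁ ℕ.⊔ K₂) (N₁ ℕ.⊔ N₂) N≤n
          Nn = ⊔-right (K₁ ℕ.⊔ K₂) (N₁ ℕ.⊔ N₂) N≤n
      in add-small (seq x n ℚ.* (seq y n ℚ.- seq y′ n)) (seq y′ n ℚ.* (seq x n ℚ.- seq x′ n))
           (mul-sub (seq x n) (seq y n) (seq x′ n) (seq y′ n))
           (α-ok (seq x n) (seq y n ℚ.- seq y′ n) (x<A n (⊔-left K₁ K₂ Kn)) (y-close n (⊔-left N₁ N₂ Nn)))
           (β-ok (seq y′ n) (seq x n ℚ.- seq x′ n) (y′<B n (⊔-right K₁ K₂ Kn)) (x-close n (⊔-right N₁ N₂ Nn)))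

ℝ-commutativeRing : CommutativeRing 0ℓ 0ℓ
ℝ-commutativeRing = record
  { Carrier = ℝ ; _≈_ = _≈_ ; _+_ = _+_ ; _*_ = _*_ ; -_ = -_ ; 0# = 0ℝ ; 1# = 1ℝ
  ; isCommutativeRing = record
    { isRing = record
      { +-isAbelianGroup = record
        { isGroup = record
          { isMonoid = record
            { isSemigroup = record
              { isMagma = record
                { isEquivalence = record { refl = ≈-refl ; sym = ≈-sym ; trans = ≈-trans }
                ; ∙-cong = +-cong
                }
              ; assoc = λ x y z → ≡⇒≈ λ n → ℚₚ.+-assoc (seq x n) (seq y n) (seq z n)
              }
            ; identity = (λ x → ≡⇒≈ λ n → ℚₚ.+-identityˡ (seq x n))
                       , (λ x → ≡⇒≈ λ n → ℚₚ.+-identityʳ (seq x n))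
            }
          ; inverse = (λ x → ≡⇒≈ λ n → ℚₚ.+-inverseˡ (seq x n))
                    , (λ x → ≡⇒≈ λ n → ℚₚ.+-inverseʳ (seq x n))
          ; ⁻¹-cong = -‿cong
          }
        ; comm = λ x y → ≡⇒≈ λ n → ℚₚ.+-comm (seq x n) (seq y n)
        }
      ; *-cong = *-cong
      ; *-assoc = λ x y z → ≡⇒≈ λ n → ℚₚ.*-assoc (seq x n) (seq y n) (seq z n)
      ; *-identity = (λ x → ≡⇒≈ λ n → ℚₚ.*-identityˡ (seq x n))
                   , (λ x → ≡⇒≈ λ n → ℚₚ.*-identityʳ (seq x n))
      ; distrib = (λ x y z → ≡⇒≈ λ n → ℚₚ.*-distribˡ-+ (seq x n) (seq y n) (seq z n))
                , (λ x y z → ≡⇒≈ λ n → ℚₚ.*-distribʳ-+ (seq x n) (seq y n) (seq z n))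
      }
    ; *-comm = λ x y → ≡⇒≈ λ n → ℚₚ.*-comm (seq x n) (seq y n)
    }
  }

open SemiringSum (CommutativeRing.semiring ℝ-commutativeRing) public using (sum)

record Graph (n : ℕ) : Set where
  field
    adj    : Fin n → Fin n → Bool
    adjSym : ∀ i j → adj i j ≡ adj j i
    noLoop : ∀ i → adj i i ≡ false

open Graph public

Matrix : ℕ → Set
Matrix n = Fin n → Fin n → ℝ

adjacencyMatrix : ∀ {n} → Graph n → Matrix n
adjacencyMatrix G i j = if adj G i j then 1ℝ else 0ℝ

infixr 7 _·_

_·_ : ∀ {n} → Matrix n → Vector ℝ n → Vector ℝ n
(A · v) i = sum λ j → A i j * v j

InKernel : ∀ {n} → Matrix n → Vector ℝ n → Set
InKernel A v = ∀ i → (A · v) i ≈ 0ℝ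

record IsKernelBasis {n} (A : Matrix n) (v : Vector ℝ n) : Set where
  field
    inKernel    : InKernel A v
    independent : ∀ c → (∀ i → c * v i ≈ 0ℝ) → c ≈ 0ℝ
    spans       : ∀ w → InKernel A w → ∃[ c ] (∀ i → w i ≈ c * v i)

record IsNut {n} (G : Graph n) : Set where
  field
    nontrivial   : 1 ℕ.< n
    kernelVector : Vector ℝ n
    isBasis      : IsKernelBasis (adjacencyMatrix G) kernelVector
    noZeroEntry  : ∀ i → ¬ (kernelVector i ≈ 0ℝ)

IsAutomorphism : ∀ {n} → Graph n → Permutation′ n → Set
IsAutomorphism G π = ∀ i j → adj G (π ⟨$⟩ʳ i) (π ⟨$⟩ʳ j) ≡ adj G i j

VertexTransitive : ∀ {n} → Graph n → Set
VertexTransitive G = ∀ i j → ∃[ π ] IsAutomorphism G π × π ⟨$⟩ʳ i ≡ j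

neighbours : ∀ {n} → Graph n → Fin n → Subset n
neighbours G i = tabulate (adj G i)

RegularOfDegree : ∀ {n} → Graph n → ℕ → Set
RegularOfDegree G d = ∀ i → ∣ neighbours G i ∣ ≡ d

{-# OPTIONS --safe #-}
module Submission where

-- An automorphism π sends the kernel vector v to a multiple v ∘ π = c v, and c² = 1 because π preserves
-- Σ vᵢ². By transitivity all entries of v are then ± the same number, so every vertex has as many
-- neighbours of positive sign as of negative sign, say k of each, and d = 2k. Counting the edges at positive
-- vertices gives n = 2m with m the number of positive vertices, and m k is even since the positive vertices
-- induce a k-regular graph. Finally d = 0 and n = d + 2 are impossible: an isolated vertex, or two
-- vertices with the same neighbours, yields a kernel vector having both zero and nonzero entries.

open import Defs using (Graph; IsNut; VertexTransitive; RegularOfDegree)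
open import Data.Nat using (ℕ; _+_; _≥_; _%_)
open import Data.Product using (_×_)
open import Data.Sum using (_⊎_)
open import Relation.Binary.PropositionalEquality using (_≡_)

open import Defs renaming (_+_ to _+ℝ_; _*_ to _*ℝ_; -_ to -ℝ_)
open import Algebra.Bundles using (CommutativeRing)
open import Algebra.Properties.Ring (CommutativeRing.ring ℝ-commutativeRing) using (-1*x≈-x)
open import Data.Bool.Base using (Bool; true; false; if_then_else_; not)
open import Data.Bool.Properties using (not-injective; ¬-not)
open import Data.Fin.Base using (Fin; zero; suc; punchIn; punchOut)
open import Data.Fin.Permutation using (_⟨$⟩ʳ_)
open import Data.Fin.Properties using (_≟_; punchIn-punchOut; punchInᵢ≢i)
open import Data.Fin.Subset using (∣_∣)
open import Data.Nat.Base as ℕ using (zero; suc; _*_; z≤n; s≤s)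
open import Data.Nat.DivMod using (_divMod_; result; m*n%n≡0; [m+kn]%n≡m%n)
open import Data.Nat.Divisibility using (_∣_; divides; ∣m∣n⇒∣m+n; ∣m+n∣m⇒∣n; _∣0; m∣m*n; n∣m*n)
import Data.Nat.Properties as ℕₚ
open import Data.Nat.Tactic.RingSolver using (solve-∀)
open import Data.Product using (_,_; ∃-syntax; proj₁; proj₂)
open import Data.Rational.Base as ℚ using (0ℚ; 1ℚ; ½)
import Data.Rational.Properties as ℚₚ
open import Data.Rational.Solver using (module +-*-Solver)
open import Data.Sum using (inj₁; inj₂; [_,_]′)
open import Data.Vec.Base using (tabulate)
open import Function using (_∘_; const)
open import Relation.Binary.PropositionalEquality using (_≢_; refl; sym; trans; cong; cong₂; subst; subst₂; module ≡-Reasoning)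
open import Relation.Nullary using (¬_; yes; no; contradiction; does)
open +-*-Solver using (solve; _:=_; _:+_; _:*_; _:-_; :-_; con)

module ℝR = CommutativeRing ℝ-commutativeRing
import Algebra.Properties.Semiring.Mult ℝR.semiring as Multℝ
import Algebra.Properties.Semiring.Sum ℕₚ.+-*-semiring as ∑ℕ
import Algebra.Properties.Semiring.Sum ℝR.semiring as ∑ℝ
import Relation.Binary.Reasoning.Setoid ℝR.setoid as ≈-Reasoning

infixr 8 _×ℝ_
_×ℝ_ : ℕ → ℝ → ℝ
_×ℝ_ = Multℝ._×_

-- Real arithmetic: null sequences, sums of squares, square roots of one.

≈0⇒null : ∀ {x} → x ≈ 0ℝ → TendsToZero (seq x)
≈0⇒null {x} x≈0 ε 0<ε with null x≈0 ε 0<ε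
... | N , small = N , λ n N≤n → subst (λ z → ℚ.∣ z ∣ ℚ.< ε) (ℚₚ.+-identityʳ (seq x n)) (small n N≤n)

null⇒≈0 : ∀ {x} → TendsToZero (seq x) → x ≈ 0ℝ
null⇒≈0 {x} x→0 = mk≈ λ ε 0<ε → let N , small = x→0 ε 0<ε in
  N , λ n N≤n → subst (λ z → ℚ.∣ z ∣ ℚ.< ε) (sym (ℚₚ.+-identityʳ (seq x n))) (small n N≤n)

x-y≈0⇒x≈y : ∀ {x y} → x +ℝ -ℝ y ≈ 0ℝ → x ≈ y
x-y≈0⇒x≈y eq = mk≈ (≈0⇒null eq)

x≈y⇒x-y≈0 : ∀ {x y} → x ≈ y → x +ℝ -ℝ y ≈ 0ℝ
x≈y⇒x-y≈0 eq = null⇒≈0 (null eq)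

0≤p*p : ∀ p → 0ℚ ℚ.≤ p ℚ.* p
0≤p*p p with ℚₚ.≤-total 0ℚ p
... | inj₁ 0≤p = subst (ℚ._≤ p ℚ.* p) (ℚₚ.*-zeroʳ p) (ℚₚ.*-monoˡ-≤-nonNeg p {{ℚ.nonNegative 0≤p}} 0≤p)
... | inj₂ p≤0 = subst (ℚ._≤ p ℚ.* p) (ℚₚ.*-zeroʳ p) (ℚₚ.*-monoˡ-≤-nonPos p {{ℚ.nonPositive p≤0}} p≤0)

∣p*p∣<ε*ε⇒∣p∣<ε : ∀ {ε} p → 0ℚ ℚ.< ε → ℚ.∣ p ℚ.* p ∣ ℚ.< ε ℚ.* ε → ℚ.∣ p ∣ ℚ.< ε
∣p*p∣<ε*ε⇒∣p∣<ε {ε} p 0<ε p²<ε² with ℚ.∣ p ∣ ℚₚ.<? ε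
... | yes p<ε = p<ε
... | no p≮ε = contradiction (ℚₚ.<-≤-trans p²<ε² (begin
    ε ℚ.* ε             ≤⟨ ℚₚ.*-monoˡ-≤-nonNeg ε {{ℚ.nonNegative (ℚₚ.<⇒≤ 0<ε)}} ε≤∣p∣ ⟩
    ε ℚ.* ℚ.∣ p ∣        ≤⟨ ℚₚ.*-monoʳ-≤-nonNeg ℚ.∣ p ∣ {{ℚₚ.∣-∣-nonNeg p}} ε≤∣p∣ ⟩
    ℚ.∣ p ∣ ℚ.* ℚ.∣ p ∣  ≡⟨ ℚₚ.∣p*q∣≡∣p∣*∣q∣ p p ⟨
    ℚ.∣ p ℚ.* p ∣        ∎)) (ℚₚ.<-irrefl refl)
  where
  open ℚₚ.≤-Reasoning
  ε≤∣p∣ = ℚₚ.≮⇒≥ p≮ε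

-- To bring the terms of `x` below ε, ask for the terms of the square to be below ε².
x*x≈0⇒x≈0 : ∀ {x} → x *ℝ x ≈ 0ℝ → x ≈ 0ℝ
x*x≈0⇒x≈0 {x} x²≈0 = null⇒≈0 λ ε 0<ε →
  let 0<ε² = subst (ℚ._< ε ℚ.* ε) (ℚₚ.*-zeroˡ ε) (ℚₚ.*-monoˡ-<-pos ε {{ℚ.positive 0<ε}} 0<ε)
      N , small = ≈0⇒null x²≈0 (ε ℚ.* ε) 0<ε²
  in N , λ n N≤n → ∣p*p∣<ε*ε⇒∣p∣<ε (seq x n) 0<ε (small n N≤n)

-- A condition on the representing sequence, stronger than nonnegativity of its limit. Squares
-- satisfy it and sums keep it term by term, so comparisons can be made in the rationals.
NonNegSeq : ℝ → Set
NonNegSeq x = ∀ n → 0ℚ ℚ.≤ seq x n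

sum-nonNeg : ∀ {m} (t : Fin m → ℝ) → (∀ i → NonNegSeq (t i)) → NonNegSeq (sum t)
sum-nonNeg {zero}  t t≥0 n = ℚₚ.≤-refl
sum-nonNeg {suc m} t t≥0 n = ℚₚ.+-mono-≤ (t≥0 zero n) (sum-nonNeg (t ∘ suc) (t≥0 ∘ suc) n)

term≤sum : ∀ {m} (t : Fin m → ℝ) → (∀ i → NonNegSeq (t i)) → ∀ i n → seq (t i) n ℚ.≤ seq (sum t) n
term≤sum t t≥0 zero n = subst (ℚ._≤ seq (sum t) n) (ℚₚ.+-identityʳ _)
  (ℚₚ.+-monoʳ-≤ (seq (t zero) n) (sum-nonNeg (t ∘ suc) (t≥0 ∘ suc) n))
term≤sum t t≥0 (suc i) n = subst (ℚ._≤ seq (sum t) n) (ℚₚ.+-identityˡ _)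
  (ℚₚ.+-mono-≤ (t≥0 zero n) (term≤sum (t ∘ suc) (t≥0 ∘ suc) i n))

-- At every index of the sequences each square is at most the whole sum, so it is squeezed to zero.
sumOfSquares≈0⇒≈0 : ∀ {m} (x : Fin m → ℝ) → sum (λ i → x i *ℝ x i) ≈ 0ℝ → ∀ i → x i ≈ 0ℝ
sumOfSquares≈0⇒≈0 x s≈0 i = x*x≈0⇒x≈0 (null⇒≈0 λ ε 0<ε →
  let N , small = ≈0⇒null s≈0 ε 0<ε
  in N , λ n N≤n → ℚₚ.≤-<-trans
    (subst₂ ℚ._≤_ (sym (ℚₚ.0≤p⇒∣p∣≡p (sq≥0 i n)))
                  (sym (ℚₚ.0≤p⇒∣p∣≡p (sum-nonNeg sq sq≥0 n)))
      (term≤sum sq sq≥0 i n))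
    (small n N≤n))
  where
  sq : Fin _ → ℝ
  sq j = x j *ℝ x j
  sq≥0 : ∀ j → NonNegSeq (sq j)
  sq≥0 j n = 0≤p*p (seq (x j) n)

-- Multiplying by `x` turns the hypothesis into a vanishing sum of `suc k` copies of the square of
-- `x`.
1+k×x≈0⇒x≈0 : ∀ k {x} → suc k ×ℝ x ≈ 0ℝ → x ≈ 0ℝ
1+k×x≈0⇒x≈0 k {x} kx≈0 = sumOfSquares≈0⇒≈0 {suc k} (const x) (begin
    sum {suc k} (const (x *ℝ x))  ≈⟨ ∑ℝ.sum-replicate (suc k) ⟩
    suc k ×ℝ (x *ℝ x)            ≈⟨ Multℝ.×-comm-* (suc k) x x ⟨
    x *ℝ (suc k ×ℝ x)            ≈⟨ ℝR.*-congˡ kx≈0 ⟩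
    x *ℝ 0ℝ                      ≈⟨ ℝR.zeroʳ x ⟩
    0ℝ                           ∎) zero
  where open ≈-Reasoning

-- A substitute for dividing by `y`: bounded away from zero, it can be cancelled at the cost of a
-- factor 2, hence the tolerance ε/2 for the product.
½≤y∧x*y≈0⇒x≈0 : ∀ {x y} N → (∀ n → N ℕ.≤ n → ½ ℚ.≤ seq y n) → x *ℝ y ≈ 0ℝ → x ≈ 0ℝ
½≤y∧x*y≈0⇒x≈0 {x} {y} N ½≤y xy≈0 = null⇒≈0 λ ε 0<ε →
  let K , small = ≈0⇒null xy≈0 (ε ℚ.* ½) (half-pos 0<ε)
  in N ℕ.⊔ K , λ n N⊔K≤n →
    ℚₚ.*-cancelʳ-<-nonNeg ½ (begin-strict
      ℚ.∣ seq x n ∣ ℚ.* ½                ≤⟨ ℚₚ.*-monoˡ-≤-nonNeg ℚ.∣ seq x n ∣ {{ℚₚ.∣-∣-nonNeg (seq x n)}}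
                                             (½≤∣y∣ n (ℕₚ.m⊔n≤o⇒m≤o N K N⊔K≤n)) ⟩
      ℚ.∣ seq x n ∣ ℚ.* ℚ.∣ seq y n ∣     ≡⟨ ℚₚ.∣p*q∣≡∣p∣*∣q∣ (seq x n) (seq y n) ⟨
      ℚ.∣ seq x n ℚ.* seq y n ∣          <⟨ small n (ℕₚ.m⊔n≤o⇒n≤o N K N⊔K≤n) ⟩
      ε ℚ.* ½                           ∎)
  where
  open ℚₚ.≤-Reasoning
  ½≤∣y∣ : ∀ n → N ℕ.≤ n → ½ ℚ.≤ ℚ.∣ seq y n ∣
  ½≤∣y∣ n N≤n = subst (½ ℚ.≤_)
    (sym (ℚₚ.0≤p⇒∣p∣≡p (ℚₚ.≤-trans (ℚₚ.nonNegative⁻¹ ½) (½≤y n N≤n)))) (½≤y n N≤n)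

∣p-q∣<½⇒½≤p+1 : ∀ p q → 0ℚ ℚ.≤ q → ℚ.∣ p ℚ.- q ∣ ℚ.< ½ → ½ ℚ.≤ p ℚ.+ 1ℚ
∣p-q∣<½⇒½≤p+1 p q 0≤q close = begin
    ½                            ≡⟨⟩
    (ℚ.- ½ ℚ.+ 0ℚ) ℚ.+ 1ℚ        ≤⟨ ℚₚ.+-monoˡ-≤ 1ℚ (ℚₚ.+-mono-≤ -½≤p-q 0≤q) ⟩
    ((p ℚ.- q) ℚ.+ q) ℚ.+ 1ℚ     ≡⟨ cong (ℚ._+ 1ℚ) (solve 2 (λ a b → (a :- b) :+ b := a) refl p q) ⟩
    p ℚ.+ 1ℚ                     ∎
  where
  open ℚₚ.≤-Reasoning
  -∣r∣≤r : ∀ r → ℚ.- ℚ.∣ r ∣ ℚ.≤ r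
  -∣r∣≤r r with ℚₚ.∣p∣≡p∨∣p∣≡-p r
  ... | inj₁ eq = ℚₚ.≤-trans (ℚₚ.neg-antimono-≤ (ℚₚ.0≤∣p∣ r)) (ℚₚ.∣p∣≡p⇒0≤p eq)
  ... | inj₂ eq = ℚₚ.≤-reflexive (trans (cong ℚ.-_ eq) (solve 1 (λ a → :- (:- a) := a) refl r))
  -½≤p-q : ℚ.- ½ ℚ.≤ p ℚ.- q
  -½≤p-q = ℚₚ.≤-trans (ℚₚ.neg-antimono-≤ (ℚₚ.<⇒≤ close)) (-∣r∣≤r (p ℚ.- q))

-- From `N` on the terms of `c` are at least -½, so those of `c + 1` are at least ½, and this factor
-- cancels from (c - 1)(c + 1) = c² - 1.
nonNeg-c*c≈1⇒c≈1 : ∀ c N → (∀ n → N ℕ.≤ n → ℚ.∣ seq c n ℚ.- seq c N ∣ ℚ.< ½) →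
  0ℚ ℚ.≤ seq c N → c *ℝ c ≈ 1ℝ → c ≈ 1ℝ
nonNeg-c*c≈1⇒c≈1 c N close c≥0 c²≈1 = x-y≈0⇒x≈y (½≤y∧x*y≈0⇒x≈0 {y = c +ℝ 1ℝ} N
  (λ n N≤n → ∣p-q∣<½⇒½≤p+1 (seq c n) (seq c N) c≥0 (close n N≤n))
  (≈-trans
    (≡⇒≈ λ n → solve 1 (λ a → (a :- con 1ℚ) :* (a :+ con 1ℚ) := a :* a :- con 1ℚ) refl (seq c n))
    (x≈y⇒x-y≈0 c²≈1)))

-- The sign of a Cauchy real is not decidable in general. Here the sign of one rational term, chosen
-- so that all later terms are within ½ of it, settles the case; a negative one is handled by
-- passing to `-ℝ c`.
c*c≈1⇒c≈±1 : ∀ c → c *ℝ c ≈ 1ℝ → c ≈ 1ℝ ⊎ c ≈ -ℝ 1ℝ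
c*c≈1⇒c≈±1 c c²≈1 with cauchy c ½ (ℚₚ.positive⁻¹ ½)
... | N , close with ℚₚ.≤-total 0ℚ (seq c N)
... | inj₁ c≥0 = inj₁ (nonNeg-c*c≈1⇒c≈1 c N (λ n N≤n → close n N N≤n ℕₚ.≤-refl) c≥0 c²≈1)
... | inj₂ c≤0 = inj₂ (≈-trans (≡⇒≈ λ n → solve 1 (λ a → a := :- (:- a)) refl (seq c n)) (-‿cong -c≈1))
  where
  -c≈1 : -ℝ c ≈ 1ℝ
  -c≈1 = nonNeg-c*c≈1⇒c≈1 (-ℝ c) N
    (λ n N≤n → subst (ℚ._< ½)
      (trans (sym (ℚₚ.∣-p∣≡∣p∣ (seq c n ℚ.- seq c N)))
             (cong ℚ.∣_∣ (sym (neg-sub (seq c n) (seq c N)))))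
      (close n N N≤n ℕₚ.≤-refl))
    (ℚₚ.neg-antimono-≤ c≤0)
    (≈-trans (≡⇒≈ λ n → solve 1 (λ a → (:- a) :* (:- a) := a :* a) refl (seq c n)) c²≈1)

-- Sums against basis vectors, signed sums and natural multiples.

⟦_⟧ : Bool → ℕ
⟦ b ⟧ = if b then 1 else 0

basis : ∀ {n} → Fin n → Fin n → ℝ
basis i j = if does (i ≟ j) then 1ℝ else 0ℝ

-- With `f` a row of the adjacency matrix, this says that applying the matrix to a basis vector
-- picks out a column.
sum-f*basis : ∀ {n} (f : Fin n → ℝ) i → sum (λ j → f j *ℝ basis i j) ≈ f i
sum-f*basis {suc n} f zero = begin
    f zero *ℝ 1ℝ +ℝ sum (λ j → f (suc j) *ℝ 0ℝ)
      ≈⟨ +-cong (ℝR.*-identityʳ (f zero))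
           (≈-trans (∑ℝ.sum-cong-≋ {n} (λ j → ℝR.zeroʳ (f (suc j)))) (∑ℝ.sum-replicate-zero n)) ⟩
    f zero +ℝ 0ℝ  ≈⟨ ℝR.+-identityʳ (f zero) ⟩
    f zero        ∎
  where open ≈-Reasoning
sum-f*basis f (suc i) = begin
    f zero *ℝ 0ℝ +ℝ sum (λ j → f (suc j) *ℝ basis i j)
      ≈⟨ +-cong (ℝR.zeroʳ (f zero)) (sum-f*basis (f ∘ suc) i) ⟩
    0ℝ +ℝ f (suc i)  ≈⟨ ℝR.+-identityˡ (f (suc i)) ⟩
    f (suc i)        ∎
  where open ≈-Reasoning

sum-f*[u-v] : ∀ {n} (f u v : Fin n → ℝ) →
  sum (λ j → f j *ℝ (u j +ℝ -ℝ v j)) ≈ sum (λ j → f j *ℝ u j) +ℝ -ℝ sum (λ j → f j *ℝ v j)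
sum-f*[u-v] {zero}  f u v = ≡⇒≈ λ _ → refl
sum-f*[u-v] {suc n} f u v = ≈-trans
  (ℝR.+-congˡ (sum-f*[u-v] (f ∘ suc) (u ∘ suc) (v ∘ suc)))
  (≡⇒≈ λ m → solve 5 (λ f u v U V → f :* (u :- v) :+ (U :- V) := (f :* u :+ U) :- (f :* v :+ V)) refl
    (seq (f zero) m) (seq (u zero) m) (seq (v zero) m)
    (seq (sum (λ j → f (suc j) *ℝ u (suc j))) m) (seq (sum (λ j → f (suc j) *ℝ v (suc j))) m))

± : Bool → ℝ → ℝ
± s y = if s then y else -ℝ y

-- Turns a row of the kernel equation, once all entries are ± one number, into a comparison of two
-- neighbour counts.
sum-± : ∀ {n} (a s : Fin n → Bool) y →
  sum (λ j → (if a j then 1ℝ else 0ℝ) *ℝ ± (s j) y) ≈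
  ∑ℕ.sum (λ j → ⟦ a j ⟧ ℕ.* ⟦ s j ⟧) ×ℝ y +ℝ -ℝ (∑ℕ.sum (λ j → ⟦ a j ⟧ ℕ.* ⟦ not (s j) ⟧) ×ℝ y)
sum-± {zero}  a s y = ≡⇒≈ λ _ → refl
sum-± {suc n} a s y = ≈-trans (ℝR.+-congˡ (sum-± (a ∘ suc) (s ∘ suc) y)) (step (a zero) (s zero))
  where
  P M : ℕ
  P = ∑ℕ.sum (λ j → ⟦ a (suc j) ⟧ ℕ.* ⟦ s (suc j) ⟧)
  M = ∑ℕ.sum (λ j → ⟦ a (suc j) ⟧ ℕ.* ⟦ not (s (suc j)) ⟧)
  step : ∀ a₀ s₀ → (if a₀ then 1ℝ else 0ℝ) *ℝ ± s₀ y +ℝ (P ×ℝ y +ℝ -ℝ (M ×ℝ y)) ≈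
         (⟦ a₀ ⟧ ℕ.* ⟦ s₀ ⟧ ℕ.+ P) ×ℝ y +ℝ -ℝ ((⟦ a₀ ⟧ ℕ.* ⟦ not s₀ ⟧ ℕ.+ M) ×ℝ y)
  step false s₀ = ≡⇒≈ λ m → solve 3 (λ z p q → con 0ℚ :* z :+ (p :- q) := p :- q) refl
    (seq (± s₀ y) m) (seq (P ×ℝ y) m) (seq (M ×ℝ y) m)
  step true true = ≡⇒≈ λ m → solve 3 (λ z p q → con 1ℚ :* z :+ (p :- q) := (z :+ p) :- q) refl
    (seq y m) (seq (P ×ℝ y) m) (seq (M ×ℝ y) m)
  step true false = ≡⇒≈ λ m → solve 3 (λ z p q → con 1ℚ :* (:- z) :+ (p :- q) := p :- (z :+ q)) refl
    (seq y m) (seq (P ×ℝ y) m) (seq (M ×ℝ y) m)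

-- Subtracting `m` copies of `x` leaves a positive multiple of `x` equal to zero.
m<n⇒m×x≉n×x : ∀ {m n x} → m ℕ.< n → ¬ x ≈ 0ℝ → ¬ m ×ℝ x ≈ n ×ℝ x
m<n⇒m×x≉n×x {m} {n} {x} m<n x≉0 eq with ℕₚ.m≤n⇒∃[o]m+o≡n m<n
... | o , refl = x≉0 (1+k×x≈0⇒x≈0 o (begin
    suc o ×ℝ x                               ≈⟨ ≡⇒≈ (λ i → solve 2 (λ a b → a := (b :+ a) :- b) refl (seq (suc o ×ℝ x) i) (seq (m ×ℝ x) i)) ⟩
    (m ×ℝ x +ℝ suc o ×ℝ x) +ℝ -ℝ (m ×ℝ x)    ≈⟨ ℝR.+-congʳ (Multℝ.×-homo-+ x m (suc o)) ⟨
    (m ℕ.+ suc o) ×ℝ x +ℝ -ℝ (m ×ℝ x)        ≡⟨ cong (λ k → k ×ℝ x +ℝ -ℝ (m ×ℝ x)) (ℕₚ.+-suc m o) ⟩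
    suc (m ℕ.+ o) ×ℝ x +ℝ -ℝ (m ×ℝ x)        ≈⟨ x≈y⇒x-y≈0 (≈-sym eq) ⟩
    0ℝ                                       ∎))
  where
  open ≈-Reasoning

×-injectiveˡ : ∀ {m n x} → ¬ x ≈ 0ℝ → m ×ℝ x ≈ n ×ℝ x → m ≡ n
×-injectiveˡ {m} {n} x≉0 eq = ℕₚ.≤-antisym
  (ℕₚ.≮⇒≥ λ n<m → m<n⇒m×x≉n×x n<m x≉0 (≈-sym eq))
  (ℕₚ.≮⇒≥ λ m<n → m<n⇒m×x≉n×x m<n x≉0 eq)

-- The kernel of a nut graph and the action of automorphisms on it.

module NutGraph {n} (G : Graph n) (nut : IsNut G) where
  open IsNut nut public renaming (kernelVector to v)
  open IsKernelBasis isBasis public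

  A : Matrix n
  A = adjacencyMatrix G

  -- Since `w` is c v, the products w i · v j and w j · v i agree; the first is v j and the second
  -- is 0, but v has no zero entry.
  noMixedKernelVector : ∀ w → InKernel A w → ∀ {i j} → w i ≈ 1ℝ → ¬ w j ≈ 0ℝ
  noMixedKernelVector w w∈ker {i} {j} wi≈1 wj≈0 with spans w w∈ker
  ... | c , w≈cv = noZeroEntry j (begin
      v j                 ≈⟨ ℝR.*-identityˡ (v j) ⟨
      1ℝ *ℝ v j           ≈⟨ ℝR.*-congʳ (≈-trans (≈-sym wi≈1) (w≈cv i)) ⟩
      (c *ℝ v i) *ℝ v j   ≈⟨ ≡⇒≈ (λ m → solve 3 (λ c a b → (c :* a) :* b := (c :* b) :* a) refl
                               (seq c m) (seq (v i) m) (seq (v j) m)) ⟩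
      (c *ℝ v j) *ℝ v i   ≈⟨ ℝR.*-congʳ (≈-trans (≈-sym (w≈cv j)) wj≈0) ⟩
      0ℝ *ℝ v i           ≈⟨ ℝR.zeroˡ (v i) ⟩
      0ℝ                  ∎)
    where
    open ≈-Reasoning

  ∘-automorphism-inKernel : ∀ π → IsAutomorphism G π → InKernel A (v ∘ (π ⟨$⟩ʳ_))
  ∘-automorphism-inKernel π aut i = begin
      sum (λ j → A i j *ℝ v (π ⟨$⟩ʳ j))
        ≈⟨ ∑ℝ.sum-cong-≋ {n} (λ j → ℝR.*-congʳ (ℝR.reflexive (cong (λ b → if b then 1ℝ else 0ℝ) (sym (aut i j))))) ⟩
      sum (λ j → A (π ⟨$⟩ʳ i) (π ⟨$⟩ʳ j) *ℝ v (π ⟨$⟩ʳ j))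
        ≈⟨ ∑ℝ.sum-permute (λ j → A (π ⟨$⟩ʳ i) j *ℝ v j) π ⟨
      (A · v) (π ⟨$⟩ʳ i)
        ≈⟨ inKernel (π ⟨$⟩ʳ i) ⟩
      0ℝ ∎
    where open ≈-Reasoning

  sum-[x*v]² : ∀ x → sum (λ i → (x *ℝ v i) *ℝ (x *ℝ v i)) ≈ (x *ℝ x) *ℝ sum (λ i → v i *ℝ v i)
  sum-[x*v]² x = ≈-trans
    (∑ℝ.sum-cong-≋ {n} λ i → ≡⇒≈ λ m →
      solve 2 (λ x a → (x :* a) :* (x :* a) := (x :* x) :* (a :* a)) refl (seq x m) (seq (v i) m))
    (≈-sym (∑ℝ.*-distribˡ-sum (x *ℝ x) (λ i → v i *ℝ v i)))

  -- A permutation preserves S = Σ vᵢ², so (c² − 1) S = 0; hence the squares of (c² − 1) vᵢ add up to 0.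
  automorphism-scalar : ∀ π → IsAutomorphism G π → ∃[ c ] (c *ℝ c ≈ 1ℝ × ∀ i → v (π ⟨$⟩ʳ i) ≈ c *ℝ v i)
  automorphism-scalar π aut with spans (v ∘ (π ⟨$⟩ʳ_)) (∘-automorphism-inKernel π aut)
  ... | c , vπ≈cv = c , x-y≈0⇒x≈y (independent x (sumOfSquares≈0⇒≈0 (λ i → x *ℝ v i) Σ[xv]²≈0)) , vπ≈cv
    where
    open ≈-Reasoning
    x S : ℝ
    x = c *ℝ c +ℝ -ℝ 1ℝ
    S = sum (λ i → v i *ℝ v i)
    ccS≈S : (c *ℝ c) *ℝ S ≈ S
    ccS≈S = begin
      (c *ℝ c) *ℝ S                                ≈⟨ sum-[x*v]² c ⟨
      sum (λ i → (c *ℝ v i) *ℝ (c *ℝ v i))         ≈⟨ ∑ℝ.sum-cong-≋ {n} (λ i → *-cong (vπ≈cv i) (vπ≈cv i)) ⟨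
      sum (λ i → v (π ⟨$⟩ʳ i) *ℝ v (π ⟨$⟩ʳ i))     ≈⟨ ∑ℝ.sum-permute (λ i → v i *ℝ v i) π ⟨
      S                                            ∎
    Σ[xv]²≈0 : sum (λ i → (x *ℝ v i) *ℝ (x *ℝ v i)) ≈ 0ℝ
    Σ[xv]²≈0 = begin
      sum (λ i → (x *ℝ v i) *ℝ (x *ℝ v i))   ≈⟨ sum-[x*v]² x ⟩
      (x *ℝ x) *ℝ S
        ≈⟨ ≡⇒≈ (λ m → solve 2 (λ c S → ((c :* c :- con 1ℚ) :* (c :* c :- con 1ℚ)) :* S
                   := (c :* c :- con 1ℚ) :* ((c :* c) :* S :- S)) refl (seq c m) (seq S m)) ⟩
      x *ℝ ((c *ℝ c) *ℝ S +ℝ -ℝ S)           ≈⟨ ℝR.*-congˡ (x≈y⇒x-y≈0 ccS≈S) ⟩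
      x *ℝ 0ℝ                                ≈⟨ ℝR.zeroʳ x ⟩
      0ℝ                                     ∎

  -- An automorphism taking `r` to `j` multiplies `v` by a scalar of square 1.
  entries-±v : VertexTransitive G → ∀ r j → ∃[ s ] v j ≈ ± s (v r)
  entries-±v transitive r j with transitive r j
  ... | π , aut , refl = let c , c²≈1 , vπ≈cv = automorphism-scalar π aut in
    [ (λ c≈1 → true , (begin
        v (π ⟨$⟩ʳ r)  ≈⟨ vπ≈cv r ⟩
        c *ℝ v r      ≈⟨ ℝR.*-congʳ c≈1 ⟩
        1ℝ *ℝ v r     ≈⟨ ℝR.*-identityˡ (v r) ⟩
        v r           ∎))
    , (λ c≈-1 → false , (begin
        v (π ⟨$⟩ʳ r)  ≈⟨ vπ≈cv r ⟩
        c *ℝ v r      ≈⟨ ℝR.*-congʳ c≈-1 ⟩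
        -ℝ 1ℝ *ℝ v r  ≈⟨ -1*x≈-x (v r) ⟩
        -ℝ v r        ∎))
    ]′ (c*c≈1⇒c≈±1 c c²≈1)
    where open ≈-Reasoning

  -- Row `i` of the kernel equation reads (number of positive neighbours) · v r - (number of
  -- negative neighbours) · v r = 0, and v r is nonzero.
  balancedSigns : VertexTransitive G → Fin n → ∃[ s ]
    (∀ i → ∑ℕ.sum (λ j → ⟦ adj G i j ⟧ ℕ.* ⟦ s j ⟧) ≡ ∑ℕ.sum (λ j → ⟦ adj G i j ⟧ ℕ.* ⟦ not (s j) ⟧))
  balancedSigns transitive r = s , λ i → ×-injectiveˡ (noZeroEntry r) (x-y≈0⇒x≈y (begin
      _                                    ≈⟨ sum-± (adj G i) s (v r) ⟨
      sum (λ j → A i j *ℝ ± (s j) (v r))   ≈⟨ ∑ℝ.sum-cong-≋ {n} (λ j → ℝR.*-congˡ (proj₂ (entries-±v transitive r j))) ⟨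
      (A · v) i                            ≈⟨ inKernel i ⟩
      0ℝ                                   ∎))
    where
    open ≈-Reasoning
    s : Fin n → Bool
    s j = proj₁ (entries-±v transitive r j)

  basis-diag : ∀ (i : Fin n) → basis i i ≈ 1ℝ
  basis-diag i with i ≟ i
  ... | yes _ = ≈-refl
  ... | no i≢i = contradiction refl i≢i

  basis-offDiag : ∀ {i j : Fin n} → i ≢ j → basis i j ≡ 0ℝ
  basis-offDiag {i} {j} i≢j with i ≟ j
  ... | yes i≡j = contradiction i≡j i≢j
  ... | no _ = refl

  -- Column `i` of the matrix vanishes, so `basis i` is a kernel vector; the second vertex `k` gives
  -- it a zero entry.
  noIsolatedVertex : ∀ {i k} → i ≢ k → ¬ (∀ j → adj G j i ≡ false)
  noIsolatedVertex {i} {k} i≢k isolated = noMixedKernelVector (basis i)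
    (λ j → ≈-trans (sum-f*basis (A j) i) (ℝR.reflexive (cong (λ b → if b then 1ℝ else 0ℝ) (isolated j))))
    (basis-diag i) (ℝR.reflexive (basis-offDiag i≢k))

  -- Columns `i` and `j` agree, so the difference of the two basis vectors is in the kernel; it is 1
  -- at `i` and 0 at the third vertex `k`.
  noTwins : ∀ {i j k} → i ≢ j → i ≢ k → j ≢ k → ¬ (∀ l → adj G l i ≡ adj G l j)
  noTwins {i} {j} {k} i≢j i≢k j≢k twins = noMixedKernelVector (λ l → basis i l +ℝ -ℝ basis j l)
    (λ l → begin
      sum (λ m → A l m *ℝ (basis i m +ℝ -ℝ basis j m))                    ≈⟨ sum-f*[u-v] (A l) (basis i) (basis j) ⟩
      sum (λ m → A l m *ℝ basis i m) +ℝ -ℝ sum (λ m → A l m *ℝ basis j m)  ≈⟨ x≈y⇒x-y≈0 (begin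
        sum (λ m → A l m *ℝ basis i m)  ≈⟨ sum-f*basis (A l) i ⟩
        A l i                           ≡⟨ cong (λ b → if b then 1ℝ else 0ℝ) (twins l) ⟩
        A l j                           ≈⟨ sum-f*basis (A l) j ⟨
        sum (λ m → A l m *ℝ basis j m)  ∎) ⟩
      0ℝ                                                                  ∎)
    (begin
      basis i i +ℝ -ℝ basis j i  ≈⟨ +-cong (basis-diag i) (-‿cong (ℝR.reflexive (basis-offDiag (i≢j ∘ sym)))) ⟩
      1ℝ +ℝ -ℝ 0ℝ        ≈⟨ ≡⇒≈ (λ _ → refl) ⟩
      1ℝ                 ∎)
    (begin
      basis i k +ℝ -ℝ basis j k  ≡⟨ cong₂ (λ x y → x +ℝ -ℝ y) (basis-offDiag i≢k) (basis-offDiag j≢k) ⟩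
      0ℝ +ℝ -ℝ 0ℝ        ≈⟨ ≡⇒≈ (λ _ → refl) ⟩
      0ℝ                 ∎)
    where open ≈-Reasoning

-- Counting with Boolean predicates.

count : ∀ {n} → (Fin n → Bool) → ℕ
count f = ∑ℕ.sum (⟦_⟧ ∘ f)

∣tabulate∣≡count : ∀ {n} (f : Fin n → Bool) → ∣ tabulate f ∣ ≡ count f
∣tabulate∣≡count {zero}  f = refl
∣tabulate∣≡count {suc n} f with f zero
... | true  = cong suc (∣tabulate∣≡count (f ∘ suc))
... | false = ∣tabulate∣≡count (f ∘ suc)

⟦b⟧+⟦not-b⟧≡1 : ∀ b → ⟦ b ⟧ + ⟦ not b ⟧ ≡ 1
⟦b⟧+⟦not-b⟧≡1 true  = refl
⟦b⟧+⟦not-b⟧≡1 false = refl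

sum-const : ∀ n c → ∑ℕ.sum {n} (const c) ≡ n * c
sum-const zero    c = refl
sum-const (suc n) c = cong (c +_) (sum-const n c)

count+count-not : ∀ {n} (f : Fin n → Bool) → count f + count (not ∘ f) ≡ n
count+count-not {n} f = begin
  count f + count (not ∘ f)              ≡⟨ ∑ℕ.∑-distrib-+ (⟦_⟧ ∘ f) (⟦_⟧ ∘ not ∘ f) ⟨
  ∑ℕ.sum (λ j → ⟦ f j ⟧ + ⟦ not (f j) ⟧)  ≡⟨ ∑ℕ.sum-cong-≗ (⟦b⟧+⟦not-b⟧≡1 ∘ f) ⟩
  ∑ℕ.sum {n} (const 1)                   ≡⟨ sum-const n 1 ⟩
  n * 1                                  ≡⟨ ℕₚ.*-identityʳ n ⟩
  n                                      ∎
  where open ≡-Reasoning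

count≡0⇒false : ∀ {n} (f : Fin n → Bool) → count f ≡ 0 → ∀ j → f j ≡ false
count≡0⇒false f eq zero with f zero
... | false = refl
count≡0⇒false f eq (suc j) = count≡0⇒false (f ∘ suc) (ℕₚ.m+n≡0⇒n≡0 ⟦ f zero ⟧ eq) j

count≢0⇒∃true : ∀ {n} (f : Fin n → Bool) → count f ≢ 0 → ∃[ j ] f j ≡ true
count≢0⇒∃true {zero}  f ≢0 = contradiction refl ≢0
count≢0⇒∃true {suc n} f ≢0 with f zero in eq
... | true  = zero , eq
... | false = let j , fj = count≢0⇒∃true (f ∘ suc) ≢0 in suc j , fj

count-punchIn : ∀ {n} (f : Fin (suc n) → Bool) {i} → f i ≡ true → count f ≡ suc (count (f ∘ punchIn i))
count-punchIn f {i} fi = trans (∑ℕ.sum-remove (⟦_⟧ ∘ f)) (cong (λ b → ⟦ b ⟧ + count (f ∘ punchIn i)) fi)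

count≡1⇒unique : ∀ {n} (f : Fin n → Bool) → count f ≡ 1 → ∀ {i j} → f i ≡ true → f j ≡ true → j ≡ i
count≡1⇒unique {suc n} f eq {i} {j} fi fj with i ≟ j
... | yes i≡j = sym i≡j
... | no i≢j = contradiction
  (trans (sym fj) (trans (cong f (sym (punchIn-punchOut i≢j)))
    (count≡0⇒false (f ∘ punchIn i) (ℕₚ.suc-injective (trans (sym (count-punchIn f fi)) eq)) (punchOut i≢j))))
  λ ()

count≡2⇒∃!other : ∀ {n} (f : Fin n → Bool) → count f ≡ 2 → ∀ {i} → f i ≡ true →
  ∃[ x ] (x ≢ i × f x ≡ true × ∀ {y} → y ≢ i → f y ≡ true → y ≡ x)
count≡2⇒∃!other {suc n} f eq {i} fi = punchIn i x , punchInᵢ≢i i x , fx , λ {y} y≢i fy →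
    let i≢y = y≢i ∘ sym in
    trans (sym (punchIn-punchOut i≢y))
      (cong (punchIn i) (count≡1⇒unique f′ f′≡1 fx (trans (cong f (punchIn-punchOut i≢y)) fy)))
  where
  f′ : Fin n → Bool
  f′ = f ∘ punchIn i
  f′≡1 : count f′ ≡ 1
  f′≡1 = ℕₚ.suc-injective (trans (sym (count-punchIn f fi)) eq)
  other : ∃[ x ] f′ x ≡ true
  other = count≢0⇒∃true f′ λ f′≡0 → contradiction (trans (sym f′≡1) f′≡0) λ ()
  x = proj₁ other
  fx = proj₂ other

-- Double counting with symmetric matrices.

-- The handshake lemma: peel off the first row and the first column, which have equal sums by
-- symmetry, and induct on the remaining minor.
sum-symmetric-even : ∀ {n} (f : Fin n → Fin n → ℕ) → (∀ i j → f i j ≡ f j i) → (∀ i → f i i ≡ 0) →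
  2 ∣ ∑ℕ.sum (λ i → ∑ℕ.sum (f i))
sum-symmetric-even {zero}  f f-sym f-diag = 2 ∣0
sum-symmetric-even {suc n} f f-sym f-diag = subst (2 ∣_) (sym split)
  (∣m∣n⇒∣m+n (m∣m*n row)
    (sum-symmetric-even (λ i j → f (suc i) (suc j)) (λ i j → f-sym (suc i) (suc j)) (f-diag ∘ suc)))
  where
  open ≡-Reasoning
  row rest : ℕ
  row = ∑ℕ.sum (λ j → f zero (suc j))
  rest = ∑ℕ.sum (λ i → ∑ℕ.sum (λ j → f (suc i) (suc j)))
  double : ∀ r s → (0 + r) + (r + s) ≡ 2 * r + s
  double = solve-∀
  split : ∑ℕ.sum (λ i → ∑ℕ.sum (f i)) ≡ 2 * row + rest
  split = begin
    (f zero zero + row) + ∑ℕ.sum (λ i → f (suc i) zero + ∑ℕ.sum (λ j → f (suc i) (suc j)))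
      ≡⟨ cong₂ _+_ (cong (_+ row) (f-diag zero)) (∑ℕ.∑-distrib-+ (λ i → f (suc i) zero) _) ⟩
    (0 + row) + (∑ℕ.sum (λ i → f (suc i) zero) + rest)
      ≡⟨ cong (λ z → (0 + row) + (z + rest)) (∑ℕ.sum-cong-≗ λ i → f-sym (suc i) zero) ⟩
    (0 + row) + (row + rest)
      ≡⟨ double row rest ⟩
    2 * row + rest ∎

-- Sum a i j · p j in two ways: by rows it is n k, by columns it is 2k times the sum of `p`. Then
-- cancel `k`.
halvedRows⇒n≡2p : ∀ {n} (a : Fin n → Fin n → ℕ) (p : Fin n → ℕ) {k} → k ≢ 0 →
  (∀ i j → a i j ≡ a j i) → (∀ i → ∑ℕ.sum (a i) ≡ k + k) →
  (∀ i → ∑ℕ.sum (λ j → a i j * p j) ≡ k) → n ≡ ∑ℕ.sum p + ∑ℕ.sum p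
halvedRows⇒n≡2p {n} a p {k} k≢0 a-sym rows halves = ℕₚ.*-cancelʳ-≡ n (m + m) k {{ℕ.≢-nonZero k≢0}} (begin
    n * k                                       ≡⟨ sum-const n k ⟨
    ∑ℕ.sum {n} (const k)                        ≡⟨ ∑ℕ.sum-cong-≗ halves ⟨
    ∑ℕ.sum (λ i → ∑ℕ.sum (λ j → a i j * p j))   ≡⟨ ∑ℕ.∑-comm (λ i j → a i j * p j) ⟩
    ∑ℕ.sum (λ j → ∑ℕ.sum (λ i → a i j * p j))   ≡⟨ ∑ℕ.sum-cong-≗ column ⟩
    ∑ℕ.sum (λ j → (k + k) * p j)                ≡⟨ ∑ℕ.*-distribˡ-sum (k + k) p ⟨
    (k + k) * m                                 ≡⟨ regroup k m ⟩
    (m + m) * k                                 ∎)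
  where
  open ≡-Reasoning
  m : ℕ
  m = ∑ℕ.sum p
  regroup : ∀ k m → (k + k) * m ≡ (m + m) * k
  regroup = solve-∀
  column : ∀ j → ∑ℕ.sum (λ i → a i j * p j) ≡ (k + k) * p j
  column j = begin
    ∑ℕ.sum (λ i → a i j * p j)  ≡⟨ ∑ℕ.*-distribʳ-sum (p j) (λ i → a i j) ⟨
    ∑ℕ.sum (λ i → a i j) * p j  ≡⟨ cong (_* p j) (∑ℕ.sum-cong-≗ (λ i → a-sym i j)) ⟩
    ∑ℕ.sum (a j) * p j          ≡⟨ cong (_* p j) (rows j) ⟩
    (k + k) * p j               ∎

-- The handshake lemma for p i · a i j · p j; when `p` indicates a vertex set, this is the adjacency
-- matrix of the induced subgraph, whose degrees are all `k`.
halvedRows⇒2∣p*k : ∀ {n} (a : Fin n → Fin n → ℕ) (p : Fin n → ℕ) {k} →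
  (∀ i j → a i j ≡ a j i) → (∀ i → a i i ≡ 0) →
  (∀ i → ∑ℕ.sum (λ j → a i j * p j) ≡ k) → 2 ∣ ∑ℕ.sum p * k
halvedRows⇒2∣p*k a p {k} a-sym a-diag halves = subst (2 ∣_) total
  (sum-symmetric-even (λ i j → p i * (a i j * p j))
    (λ i j → trans (cong (λ z → p i * (z * p j)) (a-sym i j)) (swap (p i) (a j i) (p j)))
    (λ i → trans (cong (λ z → p i * (z * p i)) (a-diag i)) (ℕₚ.*-zeroʳ (p i))))
  where
  open ≡-Reasoning
  swap : ∀ x y z → x * (y * z) ≡ z * (y * x)
  swap = solve-∀
  total : ∑ℕ.sum (λ i → ∑ℕ.sum (λ j → p i * (a i j * p j))) ≡ ∑ℕ.sum p * k
  total = begin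
    ∑ℕ.sum (λ i → ∑ℕ.sum (λ j → p i * (a i j * p j)))
      ≡⟨ ∑ℕ.sum-cong-≗ (λ i → ∑ℕ.*-distribˡ-sum (p i) (λ j → a i j * p j)) ⟨
    ∑ℕ.sum (λ i → p i * ∑ℕ.sum (λ j → a i j * p j))
      ≡⟨ ∑ℕ.sum-cong-≗ (λ i → cong (p i *_) (halves i)) ⟩
    ∑ℕ.sum (λ i → p i * k)
      ≡⟨ ∑ℕ.*-distribʳ-sum k p ⟨
    ∑ℕ.sum p * k ∎

-- Arithmetic modulo 2 and 4.

m+m≡m*2 : ∀ m → m + m ≡ m * 2
m+m≡m*2 = solve-∀

evenOrOdd : ∀ k → ∃[ l ] (k ≡ l * 2 ⊎ k ≡ 1 + l * 2)
evenOrOdd k with k divMod 2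
... | result l zero       eq = l , inj₁ eq
... | result l (suc zero) eq = l , inj₂ eq

-- e is the number of non-neighbours of a vertex, the vertex itself included.
parityConditions : ∀ m k e → 2 ∣ m * k → m + m ≡ (k + k) + e → e ≢ 0 → e ≢ 2 →
  ((k + k) % 4 ≡ 0 × (m + m) % 2 ≡ 0 × m + m ≥ (k + k) + 4) ⊎
  ((k + k) % 4 ≡ 2 × (m + m) % 4 ≡ 0 × m + m ≥ (k + k) + 6)
parityConditions m k e 2∣mk n≡d+e e≢0 e≢2
  -- Both n and d are even, hence so is `e`; with 0 and 2 excluded it is at least 4.
  with ∣m+n∣m⇒∣n (subst (2 ∣_) n≡d+e (divides m (m+m≡m*2 m))) (divides k (m+m≡m*2 k))
... | divides 0 refl = contradiction refl e≢0
... | divides 1 refl = contradiction refl e≢2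
... | divides (suc (suc t)) refl with evenOrOdd k
... | l , inj₁ refl = inj₁
  ( trans (cong (_% 4) (d≡ l)) (m*n%n≡0 l 4)
  , trans (cong (_% 2) (m+m≡m*2 m)) (m*n%n≡0 m 2)
  , subst (l * 2 + l * 2 + 4 ℕ.≤_) (sym n≡d+e) (ℕₚ.+-monoʳ-≤ (l * 2 + l * 2) (s≤s (s≤s (s≤s (s≤s z≤n))))))
  where
  d≡ : ∀ l → l * 2 + l * 2 ≡ l * 4
  d≡ = solve-∀
-- For odd `k` the evenness of m k forces `m` to be even, so 4 divides n = 2m.
... | l , inj₂ refl with ∣m+n∣m⇒∣n (subst (2 ∣_) (expand m l) 2∣mk) (n∣m*n (m * l))
  where
  expand : ∀ m l → m * (1 + l * 2) ≡ (m * l) * 2 + m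
  expand = solve-∀
... | divides u refl = inj₂ (d%4 , n%4 , bound t n≡d+e)
  where
  d : ℕ
  d = (1 + l * 2) + (1 + l * 2)
  d≡ : ∀ l → (1 + l * 2) + (1 + l * 2) ≡ 2 + l * 4
  d≡ = solve-∀
  n≡ : ∀ u → u * 2 + u * 2 ≡ u * 4
  n≡ = solve-∀
  d+4≡ : ∀ l → ((1 + l * 2) + (1 + l * 2)) + 4 ≡ 2 + suc l * 4
  d+4≡ = solve-∀
  d%4 : d % 4 ≡ 2
  d%4 = trans (cong (_% 4) (d≡ l)) ([m+kn]%n≡m%n 2 l 4)
  n%4 : (u * 2 + u * 2) % 4 ≡ 0
  n%4 = trans (cong (_% 4) (n≡ u)) (m*n%n≡0 u 4)
  bound : ∀ t → u * 2 + u * 2 ≡ d + suc (suc t) * 2 → u * 2 + u * 2 ≥ d + 6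
  -- The case e = 4 would make n = d + 4 congruent to 2 modulo 4.
  bound zero    eq = contradiction
    (trans (sym n%4) (trans (cong (_% 4) (trans eq (d+4≡ l))) ([m+kn]%n≡m%n 2 (suc l) 4))) λ ()
  bound (suc t) eq = subst (_≥ d + 6) (sym eq)
    (ℕₚ.+-monoʳ-≤ d (s≤s (s≤s (s≤s (s≤s (s≤s (s≤s z≤n)))))))

-- Regular vertex-transitive nut graphs: assembling the conditions.

module TransitiveNut {n d} (G : Graph n) (transitive : VertexTransitive G) (nut : IsNut G)
                     (regular : RegularOfDegree G d) (r : Fin n) where
  open NutGraph G nut

  a : Fin n → Fin n → ℕ
  a i j = ⟦ adj G i j ⟧

  p q : Fin n → ℕ
  p j = ⟦ proj₁ (balancedSigns transitive r) j ⟧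
  q j = ⟦ not (proj₁ (balancedSigns transitive r) j) ⟧

  Σap Σaq : Fin n → ℕ
  Σap i = ∑ℕ.sum (λ j → a i j * p j)
  Σaq i = ∑ℕ.sum (λ j → a i j * q j)

  Σa≡d : ∀ i → ∑ℕ.sum (a i) ≡ d
  Σa≡d i = trans (sym (∣tabulate∣≡count (adj G i))) (regular i)

  Σa≡Σap+Σap : ∀ i → ∑ℕ.sum (a i) ≡ Σap i + Σap i
  Σa≡Σap+Σap i = begin
    ∑ℕ.sum (a i)                             ≡⟨ ∑ℕ.sum-cong-≗ split ⟩
    ∑ℕ.sum (λ j → a i j * p j + a i j * q j) ≡⟨ ∑ℕ.∑-distrib-+ (λ j → a i j * p j) (λ j → a i j * q j) ⟩
    Σap i + Σaq i                            ≡⟨ cong (Σap i +_) (proj₂ (balancedSigns transitive r) i) ⟨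
    Σap i + Σap i                            ∎
    where
    open ≡-Reasoning
    split : ∀ j → a i j ≡ a i j * p j + a i j * q j
    split j = sym (trans (sym (ℕₚ.*-distribˡ-+ (a i j) (p j) (q j)))
      (trans (cong (a i j *_) (⟦b⟧+⟦not-b⟧≡1 (proj₁ (balancedSigns transitive r) j))) (ℕₚ.*-identityʳ (a i j))))

  k : ℕ
  k = Σap r

  d≡k+k : d ≡ k + k
  d≡k+k = trans (sym (Σa≡d r)) (Σa≡Σap+Σap r)

  -- Twice either side is d, by regularity and the balance of signs.
  Σap≡k : ∀ i → Σap i ≡ k
  Σap≡k i = ℕₚ.*-cancelʳ-≡ (Σap i) k 2 (begin
    Σap i * 2      ≡⟨ m+m≡m*2 (Σap i) ⟨
    Σap i + Σap i  ≡⟨ Σa≡Σap+Σap i ⟨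
    ∑ℕ.sum (a i)   ≡⟨ Σa≡d i ⟩
    d              ≡⟨ d≡k+k ⟩
    k + k          ≡⟨ m+m≡m*2 k ⟩
    k * 2          ∎)
    where open ≡-Reasoning

  d≢0 : ∀ {r′} → r ≢ r′ → d ≢ 0
  d≢0 r≢r′ refl = noIsolatedVertex r≢r′ λ j → count≡0⇒false (adj G j) (Σa≡d j) r

  nonNeighbour : Fin n → Fin n → Bool
  nonNeighbour i = not ∘ adj G i

  nonNeighbour-refl : ∀ i → nonNeighbour i i ≡ true
  nonNeighbour-refl i = cong not (noLoop G i)

  -- Here `r` counts as its own non-neighbour, so this number is n - d.
  codegree : ℕ
  codegree = count (nonNeighbour r)

  d+nonNeighbours≡n : ∀ i → d + count (nonNeighbour i) ≡ n
  d+nonNeighbours≡n i = trans (cong (_+ count (nonNeighbour i)) (sym (Σa≡d i))) (count+count-not (adj G i))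

  codegree-const : ∀ i → count (nonNeighbour i) ≡ codegree
  codegree-const i = ℕₚ.+-cancelˡ-≡ d _ _ (trans (d+nonNeighbours≡n i) (sym (d+nonNeighbours≡n r)))

  codegree≢0 : codegree ≢ 0
  codegree≢0 codegree≡0 = contradiction (trans (sym (nonNeighbour-refl r)) (count≡0⇒false (nonNeighbour r) codegree≡0 r)) λ ()

  -- If x is the only other non-neighbour of r, then r is the only other non-neighbour of x, so r and x are twins.
  codegree≢2 : d ≢ 0 → codegree ≢ 2
  codegree≢2 d≢0 codegree≡2 with count≡2⇒∃!other (nonNeighbour r) codegree≡2 (nonNeighbour-refl r)
  ... | x , x≢r , rx , x-unique with count≡2⇒∃!other (nonNeighbour x) (trans (codegree-const x) codegree≡2) (nonNeighbour-refl x)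
                                  | count≢0⇒∃true (adj G r) (d≢0 ∘ trans (sym (Σa≡d r)))
  -- The third vertex `z` is a neighbour of `r`: it differs from `r` as there are no loops, and from
  -- `x` because `x` is a non-neighbour of `r`.
  ... | y , _ , _ , y-unique | z , rz = noTwins {r} {x} {z} (x≢r ∘ sym)
      (λ { refl → contradiction (trans (sym rz) (noLoop G r)) λ () })
      (λ { refl → contradiction (trans (sym rx) (cong not rz)) λ () })
      twins
    where
    xr : nonNeighbour x r ≡ true
    xr = trans (cong not (adjSym G x r)) rx
    r≡y : r ≡ y
    r≡y = y-unique (x≢r ∘ sym) xr
    adjacent : ∀ i j → nonNeighbour i j ≢ true → adj G j i ≡ true
    adjacent i j ¬ij = trans (adjSym G j i) (not-injective (¬-not ¬ij))
    twins : ∀ l → adj G l r ≡ adj G l x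
    twins l with l ≟ r | l ≟ x
    ... | yes refl | _        = trans (noLoop G r) (sym (not-injective rx))
    ... | no _     | yes refl = trans (not-injective xr) (sym (noLoop G x))
    ... | no l≢r   | no l≢x   = trans (adjacent r l (l≢x ∘ x-unique l≢r))
      (sym (adjacent x l λ xl → l≢r (trans (y-unique l≢x xl) (sym r≡y))))

  conditions : d ≢ 0 → (d % 4 ≡ 0 × n % 2 ≡ 0 × n ≥ d + 4) ⊎ (d % 4 ≡ 2 × n % 4 ≡ 0 × n ≥ d + 6)
  conditions d≢0 = subst₂ (λ d n → (d % 4 ≡ 0 × n % 2 ≡ 0 × n ≥ d + 4) ⊎ (d % 4 ≡ 2 × n % 4 ≡ 0 × n ≥ d + 6))
    (sym d≡k+k) (sym n≡m+m)
    (parityConditions m k codegree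
      (halvedRows⇒2∣p*k a p a-sym (λ i → cong ⟦_⟧ (noLoop G i)) Σap≡k)
      (trans (sym n≡m+m) (trans (sym (d+nonNeighbours≡n r)) (cong (_+ codegree) d≡k+k)))
      codegree≢0 (codegree≢2 d≢0))
    where
    m : ℕ
    m = ∑ℕ.sum p
    a-sym : ∀ i j → a i j ≡ a j i
    a-sym i j = cong ⟦_⟧ (adjSym G i j)
    n≡m+m : n ≡ m + m
    n≡m+m = halvedRows⇒n≡2p a p (λ k≡0 → d≢0 (trans d≡k+k (cong₂ _+_ k≡0 k≡0)))
      a-sym (λ i → trans (Σa≡d i) d≡k+k) Σap≡k

theorem5 : (n d : ℕ) (G : Graph n) → VertexTransitive G → IsNut G → RegularOfDegree G d →
    (d % 4 ≡ 0 × n % 2 ≡ 0 × n ≥ d + 4) ⊎ (d % 4 ≡ 2 × n % 4 ≡ 0 × n ≥ d + 6)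
theorem5 zero d G transitive nut regular = contradiction (IsNut.nontrivial nut) λ ()
theorem5 (suc zero) d G transitive nut regular = contradiction (IsNut.nontrivial nut) λ { (s≤s ()) }
-- The base vertex is `zero`; `suc zero` is the second vertex that excludes d = 0.
theorem5 (suc (suc n)) d G transitive nut regular = conditions (d≢0 {suc zero} λ ())
  where open TransitiveNut G transitive nut regular zero
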